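{- Let $G$ be a finite connected graph with root $r\in V(G)$, let $\mathcal{P}=\{F_1,\dots,F_t\}$ be a partition of $E(G)$, and let $g_1,\dots,g_t\in\mathbb{Z}_2^k$ be assigned to the classes. The labeling $$\lambda(v)=\sum_{e\in P(r,v)} g_{\mathrm{class}(e)}\in\mathbb{Z}_2^k,$$ where $P(r,v)$ is a path from $r$ to $v$, is well defined (independent of the chosen paths) if and only if for every cycle $C=(e_1,\dots,e_\ell)$ of $G$, $$\sum_{i=1}^{\ell} g_{\mathrm{class}(e_i)}=0\in\mathbb{Z}_2^k .$$ Moreover, it suffices to verify this last condition on the cycles of any cycle basis of $G$.
   Context: $\mathrm{class}(e)=j$ is the index with $e\in F_j$. A cycle basis of $G$ is a set of cycles whose edge sets form a basis over $\mathbb{F}_2$ of the cycle space of $G$. -}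

module Defs where

open import Data.Bool.Base using (if_then_else_)
open import Data.Fin.Base using (Fin)
open import Data.Fin.Properties using (_≟_)
open import Data.Fin.Subset using (Subset; _∈_; Nonempty)
import Data.List.Membership.DecPropositional as DecMembership
open import Data.List.Base using (List; []; _∷_; _∷ʳ_; length; filter; foldr; allFin)
import Data.List.Base as List
open import Data.List.Relation.Unary.Unique.Propositional using (Unique)
open import Data.Nat.Base using (ℕ; _≤_)
open import Data.Nat.Divisibility using (_∣_)
open import Data.Parity.Base using (Parity; 0ℙ; 1ℙ)
import Data.Parity.Base as ℙ
import Data.Parity.Properties as ℙ
open import Data.Product.Base using (∃; _×_; _,_; proj₁; proj₂)
open import Data.Sum.Base using (_⊎_)
open import Data.Vec.Base using (Vec; lookup; map; replicate; tabulate; zipWith)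
open import Level using (0ℓ)
open import Relation.Binary.PropositionalEquality.Core using (_≡_; _≢_)
open import Relation.Nullary.Decidable using (Dec; does; _×-dec_; _⊎-dec_)
open import Relation.Unary using (Pred)

-- ℤ₂ is the library's Parity, with 0ℙ, 1ℙ and addition modulo 2.

ℤ₂^_ : ℕ → Set
ℤ₂^ k = Vec Parity k

infix 9 ℤ₂^_
infixl 6 _⊕_
infixr 7 _·_

_⊕_ : ∀ {k} → ℤ₂^ k → ℤ₂^ k → ℤ₂^ k
_⊕_ = zipWith ℙ._+_

𝟎 : ∀ {k} → ℤ₂^ k
𝟎 = replicate _ 0ℙ

_·_ : ∀ {k} → Parity → ℤ₂^ k → ℤ₂^ k
c · x = map (c ℙ.*_) x

∑ : ∀ {k} → List (ℤ₂^ k) → ℤ₂^ k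
∑ = foldr _⊕_ 𝟎

linearCombination : ∀ {d m} → (Fin d → Parity) → (Fin d → ℤ₂^ m) → ℤ₂^ m
linearCombination c b = ∑ (List.map (λ i → c i · b i) (allFin _))

record IsBasis {d m : ℕ} (W : Pred (ℤ₂^ m) 0ℓ) (b : Fin d → ℤ₂^ m) : Set where
  field
    member      : ∀ i → W (b i)
    independent : ∀ c → linearCombination c b ≡ 𝟎 → ∀ i → c i ≡ 0ℙ
    spanning    : ∀ x → W x → ∃ λ c → linearCombination c b ≡ x

-- Finite simple graphs with V = Fin n and E = Fin m.  The two ends of an edge
-- are stored in an arbitrary order, which Joins forgets.

record Graph (n m : ℕ) : Set where
  field
    ends : Fin m → Fin n × Fin n

  Joins : Fin m → Fin n → Fin n → Set
  Joins e u v = ends e ≡ (u , v) ⊎ ends e ≡ (v , u)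

  field
    loopless    : ∀ e → proj₁ (ends e) ≢ proj₂ (ends e)
    no-parallel : ∀ {e e′ u v} → Joins e u v → Joins e′ u v → e ≡ e′

  Incident : Fin n → Fin m → Set
  Incident v e = proj₁ (ends e) ≡ v ⊎ proj₂ (ends e) ≡ v

  incident? : ∀ v e → Dec (Incident v e)
  incident? v e = (proj₁ (ends e) ≟ v) ⊎-dec (proj₂ (ends e) ≟ v)

module _ {n m : ℕ} (G : Graph n m) where
  open Graph G

  data Walk : Fin n → Fin n → Set where
    nil  : ∀ {u} → Walk u u
    step : ∀ {u v w} (e : Fin m) → Joins e u v → Walk v w → Walk u w

  vertices : ∀ {u v} → Walk u v → List (Fin n)
  vertices {u} nil          = u ∷ []
  vertices {u} (step _ _ p) = u ∷ vertices p

  walkEdges : ∀ {u v} → Walk u v → List (Fin m)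
  walkEdges nil          = []
  walkEdges (step e _ p) = e ∷ walkEdges p

  record Path (u v : Fin n) : Set where
    field
      walk   : Walk u v
      simple : Unique (vertices walk)

    edges : List (Fin m)
    edges = walkEdges walk

  Connected : Set
  Connected = ∀ u v → Path u v

  -- A cycle x₁ x₂ … x_ℓ x₁ is a path x₁ … x_ℓ on ℓ ≥ 3 vertices together with
  -- an edge joining x_ℓ to x₁.

  record Cycle : Set where
    field
      {first last} : Fin n
      path         : Path first last
      long         : 3 ≤ length (vertices (Path.walk path))
      closing      : Fin m
      closes       : Joins closing last first

    edges : List (Fin m)
    edges = Path.edges path ∷ʳ closing

  -- Vectors of ℤ₂^ m represent sets of edges by their indicator functions.

  edgeSet : Cycle → ℤ₂^ m
  edgeSet C = tabulate λ e → if does (e ∈? Cycle.edges C) then 1ℙ else 0ℙ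
    where open DecMembership (_≟_ {m}) using (_∈?_)

  degree : ℤ₂^ m → Fin n → ℕ
  degree x v = length (filter (λ e → (lookup x e ℙ.≟ 1ℙ) ×-dec incident? v e) (allFin m))

  CycleSpace : Pred (ℤ₂^ m) 0ℓ
  CycleSpace x = ∀ v → 2 ∣ degree x v

  IsCycleBasis : ∀ {d} → (Fin d → Cycle) → Set
  IsCycleBasis B = IsBasis CycleSpace (λ i → edgeSet (B i))

record Partition (m t : ℕ) : Set where
  field
    part     : Fin t → Subset m
    nonempty : ∀ j → Nonempty (part j)
    covers   : ∀ e → ∃ λ j → e ∈ part j
    disjoint : ∀ {i j e} → e ∈ part i → e ∈ part j → i ≡ j

  class : Fin m → Fin t
  class e = proj₁ (covers e)

module _ {m t k : ℕ} (𝓟 : Partition m t) (g : Fin t → ℤ₂^ k) where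
  open Partition 𝓟

  classSum : List (Fin m) → ℤ₂^ k
  classSum es = ∑ (List.map (λ e → g (class e)) es)

  module _ {n : ℕ} (G : Graph n m) where

    LabelingWellDefined : Fin n → Set
    LabelingWellDefined r =
      ∀ v (P Q : Path G r v) → classSum (Path.edges P) ≡ classSum (Path.edges Q)

    SumsToZero : Cycle G → Set
    SumsToZero C = classSum (Cycle.edges C) ≡ 𝟎

{-# OPTIONS --safe #-}

-- If the labeling is well defined, every edge e = uv satisfies
-- g(e) = λ(u) + λ(v), so the sum along any closed walk telescopes to 0.
-- Conversely, if cycles sum to 0, then erasing a loop from a walk does not
-- change its sum, so every walk has the sum of a path with the same ends; a
-- closed walk then sums to 0, and two paths from r to v form a closed walk.
-- For the last part, the sum over a cycle is the value at its edge set of the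
-- linear map ℤ₂^ m → ℤ₂^ k sending the indicator of {e} to g(e), and this map
-- vanishes on the cycle space as soon as it vanishes on a basis.  That edge sets
-- of cycles have even degree at v is the telescoping once more, as the
-- incidence of e = ab with v is δ(a,v) + δ(b,v).

module Submission where

open import Defs
open import Algebra.Bundles using (CommutativeMonoid)
import Algebra.Properties.CommutativeSemigroup as CommutativeSemigroupProperties
open import Data.Empty using (⊥-elim)
open import Data.Fin.Base using (Fin)
open import Data.Fin.Properties using (_≟_)
open import Data.List.Base using (List; []; _∷_; [_]; _++_; _∷ʳ_; length; filter; allFin)
import Data.List.Base as List
import Data.List.Membership.DecPropositional as DecMembership
open import Data.List.Membership.Propositional using (_∈_; _∉_)
open import Data.List.Membership.Propositional.Properties using (∈-allFin)
import Data.List.Properties as List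
open import Data.List.Relation.Unary.All.Properties using (¬Any⇒All¬)
open import Data.List.Relation.Unary.AllPairs using ([]; _∷_)
import Data.List.Relation.Unary.All as All
open import Data.List.Relation.Unary.Any using (here; there)
open import Data.List.Relation.Unary.Unique.Propositional using (Unique)
open import Data.List.Relation.Unary.Unique.Propositional.Properties
  using (allFin⁺; Unique[x∷xs]⇒x∉xs) renaming (++⁺ to Unique-++⁺)
open import Data.Bool.Base using (if_then_else_)
open import Data.Nat.Base using (ℕ; zero; suc; _≤_; z≤n; s≤s; parity)
open import Data.Nat.Divisibility using (_∣_; _∣0; ∣m∣n⇒∣m+n; ∣-refl)
open import Data.Parity.Base using (Parity; 0ℙ; 1ℙ)
import Data.Parity.Base as ℙ
import Data.Parity.Properties as ℙ
open import Data.Product.Base using (∃₂; Σ; _×_; _,_; proj₁; proj₂)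
open import Data.Sum.Base using (_⊎_; inj₁; inj₂; swap)
open import Data.Vec.Base using ([]; _∷_; lookup; head)
import Data.Vec.Properties as Vec
open import Function.Base using (_∘_)
open import Function.Bundles using (_⇔_; mk⇔)
open import Level using (0ℓ)
open import Relation.Binary.PropositionalEquality hiding ([_])
open import Relation.Nullary.Decidable using (Dec; yes; no; does; _×-dec_; _⊎-dec_)
open import Relation.Nullary.Negation using (¬_; contradiction)

open ≡-Reasoning

-- Vector arithmetic over ℤ₂.

⊕-commutativeMonoid : ℕ → CommutativeMonoid 0ℓ 0ℓ
⊕-commutativeMonoid k = record
  { Carrier = ℤ₂^ k
  ; _≈_     = _≡_
  ; _∙_     = _⊕_
  ; ε       = 𝟎
  ; isCommutativeMonoid = record
    { isMonoid = record
      { isSemigroup = record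
        { isMagma = record { isEquivalence = isEquivalence ; ∙-cong = cong₂ _⊕_ }
        ; assoc   = Vec.zipWith-assoc ℙ.+-assoc
        }
      ; identity = Vec.zipWith-identityˡ ℙ.+-identityˡ , Vec.zipWith-identityʳ ℙ.+-identityʳ
      }
    ; comm = Vec.zipWith-comm ℙ.+-comm
    }
  }

module _ {k : ℕ} where
  open CommutativeMonoid (⊕-commutativeMonoid k) public
    using () renaming (assoc to ⊕-assoc; comm to ⊕-comm;
                       identityˡ to ⊕-identityˡ; identityʳ to ⊕-identityʳ)
  open CommutativeSemigroupProperties
    (CommutativeMonoid.commutativeSemigroup (⊕-commutativeMonoid k)) public
    using () renaming (interchange to ⊕-interchange)

⊕-self : ∀ {k} (a : ℤ₂^ k) → a ⊕ a ≡ 𝟎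
⊕-self []      = refl
⊕-self (p ∷ a) = cong₂ _∷_ (ℙ.p+p≡0ℙ p) (⊕-self a)

⊕-cancelˡ : ∀ {k} (a b : ℤ₂^ k) → a ⊕ (a ⊕ b) ≡ b
⊕-cancelˡ a b = begin
  a ⊕ (a ⊕ b) ≡⟨ ⊕-assoc a a b ⟨
  (a ⊕ a) ⊕ b ≡⟨ cong (_⊕ b) (⊕-self a) ⟩
  𝟎 ⊕ b       ≡⟨ ⊕-identityˡ b ⟩
  b           ∎

⊕-telescope : ∀ {k} (a b c : ℤ₂^ k) → (a ⊕ b) ⊕ (b ⊕ c) ≡ a ⊕ c
⊕-telescope a b c = trans (⊕-assoc a b (b ⊕ c)) (cong (a ⊕_) (⊕-cancelˡ b c))

⊕≡𝟎⇒≡ : ∀ {k} (a b : ℤ₂^ k) → a ⊕ b ≡ 𝟎 → a ≡ b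
⊕≡𝟎⇒≡ a b eq = begin
  a           ≡⟨ ⊕-identityʳ a ⟨
  a ⊕ 𝟎       ≡⟨ cong (a ⊕_) eq ⟨
  a ⊕ (a ⊕ b) ≡⟨ ⊕-cancelˡ a b ⟩
  b           ∎

0ℙ· : ∀ {k} (a : ℤ₂^ k) → 0ℙ · a ≡ 𝟎
0ℙ· a = Vec.map-const a 0ℙ

1ℙ· : ∀ {k} (a : ℤ₂^ k) → 1ℙ · a ≡ a
1ℙ· = Vec.map-id

·-distribʳ : ∀ {k} (p q : Parity) (a : ℤ₂^ k) → (p ℙ.+ q) · a ≡ p · a ⊕ q · a
·-distribʳ p q []      = refl
·-distribʳ p q (c ∷ a) = cong₂ _∷_ (ℙ.*-distribʳ-+ c p q) (·-distribʳ p q a)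

-- Finite sums of vectors.

sumOver : ∀ {A : Set} {k} → (A → ℤ₂^ k) → List A → ℤ₂^ k
sumOver f xs = ∑ (List.map f xs)

module _ {A : Set} {k : ℕ} where

  sumOver-cong : {f f′ : A → ℤ₂^ k} → f ≗ f′ → sumOver f ≗ sumOver f′
  sumOver-cong eq xs = cong ∑ (List.map-cong eq xs)

  sumOver-++ : (f : A → ℤ₂^ k) → ∀ xs ys → sumOver f (xs ++ ys) ≡ sumOver f xs ⊕ sumOver f ys
  sumOver-++ f []       ys = sym (⊕-identityˡ _)
  sumOver-++ f (x ∷ xs) ys = trans (cong (f x ⊕_) (sumOver-++ f xs ys)) (sym (⊕-assoc _ _ _))

  sumOver-∷ʳ : (f : A → ℤ₂^ k) → ∀ xs x → sumOver f (xs ∷ʳ x) ≡ sumOver f xs ⊕ f x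
  sumOver-∷ʳ f xs x = trans (sumOver-++ f xs [ x ]) (cong (sumOver f xs ⊕_) (⊕-identityʳ (f x)))

  sumOver-⊕ : (f f′ : A → ℤ₂^ k) → ∀ xs →
    sumOver (λ x → f x ⊕ f′ x) xs ≡ sumOver f xs ⊕ sumOver f′ xs
  sumOver-⊕ f f′ []       = sym (⊕-identityˡ 𝟎)
  sumOver-⊕ f f′ (x ∷ xs) = begin
    (f x ⊕ f′ x) ⊕ sumOver (λ y → f y ⊕ f′ y) xs  ≡⟨ cong (_ ⊕_) (sumOver-⊕ f f′ xs) ⟩
    (f x ⊕ f′ x) ⊕ (sumOver f xs ⊕ sumOver f′ xs) ≡⟨ ⊕-interchange (f x) _ _ _ ⟩
    (f x ⊕ sumOver f xs) ⊕ (f′ x ⊕ sumOver f′ xs) ∎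

  sumOver-𝟎 : (f : A → ℤ₂^ k) → ∀ xs → (∀ {x} → x ∈ xs → f x ≡ 𝟎) → sumOver f xs ≡ 𝟎
  sumOver-𝟎 f []       eq = refl
  sumOver-𝟎 f (x ∷ xs) eq =
    trans (cong₂ _⊕_ (eq (here refl)) (sumOver-𝟎 f xs (eq ∘ there))) (⊕-identityˡ 𝟎)

-- Indicators and the linear extension of edge weights.

⟦_⟧ : {P : Set} → Dec P → Parity
⟦ P? ⟧ = if does P? then 1ℙ else 0ℙ

⟦⟧-false : {P : Set} (P? : Dec P) → ¬ P → ⟦ P? ⟧ ≡ 0ℙ
⟦⟧-false (yes p) ¬p = contradiction p ¬p
⟦⟧-false (no _)  _  = refl

⟦⟧-true : {P : Set} (P? : Dec P) → P → ⟦ P? ⟧ ≡ 1ℙ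
⟦⟧-true (yes _) _ = refl
⟦⟧-true (no ¬p) p = contradiction p ¬p

module _ {m : ℕ} where
  open DecMembership (_≟_ {m}) using (_∈?_)

  -- If `e` were already in `es`, the two terms would cancel at `x = e`; this is where
  -- repetition-free lists become essential.
  indicator-∷ : ∀ {e es} → e ∉ es → ∀ x → ⟦ x ∈? (e ∷ es) ⟧ ≡ ⟦ x ≟ e ⟧ ℙ.+ ⟦ x ∈? es ⟧
  indicator-∷ {e} {es} e∉es x with x ≟ e
  ... | no _     = refl
  ... | yes refl = sym (cong (1ℙ ℙ.+_) (⟦⟧-false (x ∈? es) e∉es))

  -- By uniqueness `e` contributes exactly once, and every other term has coefficient `0ℙ`.
  sumOver-δ : ∀ {k} (h : Fin m → ℤ₂^ k) {e xs} → Unique xs → e ∈ xs →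
    sumOver (λ x → ⟦ x ≟ e ⟧ · h x) xs ≡ h e
  sumOver-δ h {e} {x ∷ xs} u@(_ ∷ _) (here refl) = begin
    ⟦ e ≟ e ⟧ · h e ⊕ sumOver (λ y → ⟦ y ≟ e ⟧ · h y) xs
      ≡⟨ cong₂ _⊕_ (trans (cong (_· h e) (⟦⟧-true (e ≟ e) refl)) (1ℙ· (h e)))
                   (sumOver-𝟎 _ xs λ {y} y∈xs → trans
                     (cong (_· h y) (⟦⟧-false (y ≟ e) λ { refl → Unique[x∷xs]⇒x∉xs u y∈xs }))
                     (0ℙ· (h y))) ⟩
    h e ⊕ 𝟎 ≡⟨ ⊕-identityʳ (h e) ⟩
    h e ∎
  sumOver-δ h {e} {x ∷ xs} u@(_ ∷ u′) (there e∈xs) = begin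
    ⟦ x ≟ e ⟧ · h x ⊕ sumOver (λ y → ⟦ y ≟ e ⟧ · h y) xs
      ≡⟨ cong₂ _⊕_ (trans (cong (_· h x) (⟦⟧-false (x ≟ e) λ { refl → Unique[x∷xs]⇒x∉xs u e∈xs }))
                          (0ℙ· (h x)))
                   (sumOver-δ h u′ e∈xs) ⟩
    𝟎 ⊕ h e ≡⟨ ⊕-identityˡ (h e) ⟩
    h e ∎

  -- Bridge between the two encodings of an edge set, as an indicator and as a list. By induction on
  -- the list, each head splits off the indicator of a single edge.
  linearCombination-indicator : ∀ {k} (h : Fin m → ℤ₂^ k) {es} → Unique es →
    linearCombination (λ x → ⟦ x ∈? es ⟧) h ≡ sumOver h es
  linearCombination-indicator h {[]} _ = sumOver-𝟎 _ (allFin m) λ {x} _ → 0ℙ· (h x)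
  linearCombination-indicator h {e ∷ es} u@(_ ∷ u′) = begin
    sumOver (λ x → ⟦ x ∈? (e ∷ es) ⟧ · h x) (allFin m)
      ≡⟨ sumOver-cong (λ x → trans
           (cong (_· h x) (indicator-∷ (Unique[x∷xs]⇒x∉xs u) x))
           (·-distribʳ ⟦ x ≟ e ⟧ ⟦ x ∈? es ⟧ (h x))) (allFin m) ⟩
    sumOver (λ x → ⟦ x ≟ e ⟧ · h x ⊕ ⟦ x ∈? es ⟧ · h x) (allFin m)
      ≡⟨ sumOver-⊕ (λ x → ⟦ x ≟ e ⟧ · h x) _ (allFin m) ⟩
    sumOver (λ x → ⟦ x ≟ e ⟧ · h x) (allFin m) ⊕ linearCombination (λ x → ⟦ x ∈? es ⟧) h
      ≡⟨ cong₂ _⊕_ (sumOver-δ h (allFin⁺ m) (∈-allFin e)) (linearCombination-indicator h u′) ⟩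
    h e ⊕ sumOver h es ∎

  module _ {k : ℕ} (h : Fin m → ℤ₂^ k) where

    linearExtension : ℤ₂^ m → ℤ₂^ k
    linearExtension x = linearCombination (lookup x) h

    linearExtension-𝟎 : linearExtension 𝟎 ≡ 𝟎
    linearExtension-𝟎 = sumOver-𝟎 _ (allFin m) λ {e} _ →
      trans (cong (_· h e) (Vec.lookup-replicate e 0ℙ)) (0ℙ· (h e))

    linearExtension-⊕ : ∀ x y → linearExtension (x ⊕ y) ≡ linearExtension x ⊕ linearExtension y
    linearExtension-⊕ x y = trans
      (sumOver-cong (λ e → trans
        (cong (_· h e) (Vec.lookup-zipWith ℙ._+_ e x y))
        (·-distribʳ (lookup x e) (lookup y e) (h e))) (allFin m))
      (sumOver-⊕ (λ e → lookup x e · h e) _ (allFin m))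

    -- The kernel of a linear map is a subspace. Scalars take two values, so closure under multiples
    -- is a case split and the rest is additivity.
    linearExtension-kernel : ∀ {d} (c : Fin d → Parity) (b : Fin d → ℤ₂^ m) →
      (∀ i → linearExtension (b i) ≡ 𝟎) → linearExtension (linearCombination c b) ≡ 𝟎
    linearExtension-kernel {d} c b b∈ker = go (allFin d)
      where
      multiple : ∀ p x → linearExtension x ≡ 𝟎 → linearExtension (p · x) ≡ 𝟎
      multiple 0ℙ x _  = trans (cong linearExtension (0ℙ· x)) linearExtension-𝟎
      multiple 1ℙ x eq = trans (cong linearExtension (1ℙ· x)) eq

      go : ∀ is → linearExtension (sumOver (λ i → c i · b i) is) ≡ 𝟎
      go []       = linearExtension-𝟎
      go (i ∷ is) = begin
        linearExtension (c i · b i ⊕ rest)                   ≡⟨ linearExtension-⊕ (c i · b i) rest ⟩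
        linearExtension (c i · b i) ⊕ linearExtension rest   ≡⟨ cong₂ _⊕_ (multiple (c i) (b i) (b∈ker i)) (go is) ⟩
        𝟎 ⊕ 𝟎                                                ≡⟨ ⊕-identityˡ 𝟎 ⟩
        𝟎                                                    ∎
        where rest = sumOver (λ j → c j · b j) is

-- Counting modulo 2.

parity-even : ∀ n → parity n ≡ 0ℙ → 2 ∣ n
parity-even zero          _  = 2 ∣0
parity-even (suc (suc n)) eq = ∣m∣n⇒∣m+n ∣-refl (parity-even n eq)

parity-suc : ∀ n → parity (suc n) ≡ parity n ℙ.⁻¹
parity-suc n = ℙ.⁻¹-injective (trans (ℙ.suc-homo-⁻¹ n) (sym (ℙ.⁻¹-involutive (parity n))))

-- Parities are wrapped as vectors of length 1, so that counting modulo 2 becomes a `sumOver` and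
-- the general lemmas on sums apply.
length-filter-parity : ∀ {A : Set} {P : A → Set} (P? : ∀ x → Dec (P x)) xs →
  parity (length (filter P? xs)) ∷ [] ≡ sumOver (λ x → ⟦ P? x ⟧ ∷ []) xs
length-filter-parity P? []       = refl
length-filter-parity P? (x ∷ xs) with P? x
... | yes _ = trans (cong (_∷ []) (parity-suc (length (filter P? xs))))
                    (cong ((1ℙ ∷ []) ⊕_) (length-filter-parity P? xs))
... | no _  = trans (length-filter-parity P? xs) (sym (⊕-identityˡ _))

⟦⟧-×-dec : ∀ {P : Set} p (P? : Dec P) → ⟦ (p ℙ.≟ 1ℙ) ×-dec P? ⟧ ≡ p ℙ.* ⟦ P? ⟧
⟦⟧-×-dec 0ℙ P? = refl
⟦⟧-×-dec 1ℙ P? = refl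

-- Walks and paths: concatenation, reversal, splitting.

module _ {n m : ℕ} (G : Graph n m) where
  open Graph G
  open DecMembership (_≟_ {n}) using (_∈?_)

  joins-irreflexive : ∀ {e u} → ¬ Joins e u u
  joins-irreflexive {e} (inj₁ eq) = loopless e (trans (cong proj₁ eq) (sym (cong proj₂ eq)))
  joins-irreflexive {e} (inj₂ eq) = loopless e (trans (cong proj₁ eq) (sym (cong proj₂ eq)))

  joins-unique : ∀ {e a b u v} → Joins e a b → Joins e u v → (a ≡ u × b ≡ v) ⊎ (a ≡ v × b ≡ u)
  joins-unique (inj₁ p) (inj₁ q) with trans (sym p) q
  ... | refl = inj₁ (refl , refl)
  joins-unique (inj₁ p) (inj₂ q) with trans (sym p) q
  ... | refl = inj₂ (refl , refl)
  joins-unique (inj₂ p) (inj₁ q) with trans (sym p) q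
  ... | refl = inj₂ (refl , refl)
  joins-unique (inj₂ p) (inj₂ q) with trans (sym p) q
  ... | refl = inj₁ (refl , refl)

  infixr 5 _++ʷ_

  _++ʷ_ : ∀ {u v w} → Walk G u v → Walk G v w → Walk G u w
  nil        ++ʷ q = q
  step e j p ++ʷ q = step e j (p ++ʷ q)

  reverse : ∀ {u v} → Walk G u v → Walk G v u
  reverse nil          = nil
  reverse (step e j p) = reverse p ++ʷ step e (swap j) nil

  walkEdges-++ʷ : ∀ {u v w} (p : Walk G u v) (q : Walk G v w) →
    walkEdges G (p ++ʷ q) ≡ walkEdges G p ++ walkEdges G q
  walkEdges-++ʷ nil          q = refl
  walkEdges-++ʷ (step e _ p) q = cong (e ∷_) (walkEdges-++ʷ p q)

  vertices-∷ʳ : ∀ {u v w} (p : Walk G u v) {e} (j : Joins e v w) →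
    vertices G (p ++ʷ step e j nil) ≡ vertices G p ∷ʳ w
  vertices-∷ʳ nil              j = refl
  vertices-∷ʳ {u} (step _ _ p) j = cong (u ∷_) (vertices-∷ʳ p j)

  first∈vertices : ∀ {u v} (p : Walk G u v) → u ∈ vertices G p
  first∈vertices nil          = here refl
  first∈vertices (step _ _ _) = here refl

  last∈vertices : ∀ {u v} (p : Walk G u v) → v ∈ vertices G p
  last∈vertices nil          = here refl
  last∈vertices (step _ _ p) = there (last∈vertices p)

  ∈-++ʷˡ : ∀ {u v w x} (p : Walk G u v) (q : Walk G v w) →
    x ∈ vertices G p → x ∈ vertices G (p ++ʷ q)
  ∈-++ʷˡ nil          q (here refl) = first∈vertices q
  ∈-++ʷˡ (step _ _ p) q (here refl) = here refl
  ∈-++ʷˡ (step _ _ p) q (there x∈p) = there (∈-++ʷˡ p q x∈p)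

  ∈-++ʷʳ : ∀ {u v w x} (p : Walk G u v) (q : Walk G v w) →
    x ∈ vertices G q → x ∈ vertices G (p ++ʷ q)
  ∈-++ʷʳ nil          q x∈q = x∈q
  ∈-++ʷʳ (step _ _ p) q x∈q = there (∈-++ʷʳ p q x∈q)

  Simple : ∀ {u v} → Walk G u v → Set
  Simple p = Unique (vertices G p)

  simple-step : ∀ {u v w e} (j : Joins e u v) {p : Walk G v w} →
    u ∉ vertices G p → Simple p → Simple (step e j p)
  simple-step j u∉p s = ¬Any⇒All¬ _ u∉p ∷ s

  simple-++ʷˡ : ∀ {u v w} (p : Walk G u v) (q : Walk G v w) → Simple (p ++ʷ q) → Simple p
  simple-++ʷˡ nil          q _         = All.[] ∷ []
  simple-++ʷˡ (step _ j p) q s@(_ ∷ s′) =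
    simple-step j (Unique[x∷xs]⇒x∉xs s ∘ ∈-++ʷˡ p q) (simple-++ʷˡ p q s′)

  simple-++ʷʳ : ∀ {u v w} (p : Walk G u v) (q : Walk G v w) → Simple (p ++ʷ q) → Simple q
  simple-++ʷʳ nil          q s        = s
  simple-++ʷʳ (step _ _ p) q (_ ∷ s) = simple-++ʷʳ p q s

  -- Every vertex of `p` before its last is followed in the composite by all vertices of `q`, so
  -- finding it again on `q` would be a repetition.
  simple-++ʷ-meet : ∀ {u v w x} (p : Walk G u v) (q : Walk G v w) → Simple (p ++ʷ q) →
    x ∈ vertices G p → x ∈ vertices G q → x ≡ v
  simple-++ʷ-meet nil          q _         (here refl) _   = refl
  simple-++ʷ-meet (step _ _ p) q s         (here refl) x∈q =
    contradiction (∈-++ʷʳ p q x∈q) (Unique[x∷xs]⇒x∉xs s)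
  simple-++ʷ-meet (step _ _ p) q (_ ∷ s)   (there x∈p) x∈q = simple-++ʷ-meet p q s x∈p x∈q

  simple-∷ʳ : ∀ {u v w e} (p : Walk G u v) (j : Joins e v w) → Simple p → w ∉ vertices G p →
    Simple (p ++ʷ step e j nil)
  simple-∷ʳ p j s w∉p = subst Unique (sym (vertices-∷ʳ p j))
    (Unique-++⁺ s (All.[] ∷ []) λ { (x∈p , here refl) → w∉p x∈p })

  -- A closed walk with at least one step lists its base vertex both first and last.
  simple-closed : ∀ {u} (p : Walk G u u) → Simple p → p ≡ nil
  simple-closed nil          _ = refl
  simple-closed (step _ _ p) s = contradiction (last∈vertices p) (Unique[x∷xs]⇒x∉xs s)

  splitAt : ∀ {u v x} (p : Walk G u v) → x ∈ vertices G p →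
    ∃₂ λ (q : Walk G u x) (q′ : Walk G x v) → p ≡ q ++ʷ q′
  splitAt nil          (here refl) = nil , nil , refl
  splitAt (step e j p) (here refl) = nil , step e j p , refl
  splitAt (step e j p) (there x∈p) with splitAt p x∈p
  ... | q , q′ , refl = step e j q , q′ , refl

  -- Paths and cycles repeat no edge.

  end∈vertices : ∀ {u v e a b} (p : Walk G u v) → e ∈ walkEdges G p → Joins e a b → a ∈ vertices G p
  end∈vertices (step _ j p) (here refl) j′ with joins-unique j′ j
  ... | inj₁ (refl , _) = here refl
  ... | inj₂ (refl , _) = there (first∈vertices p)
  end∈vertices (step _ _ p) (there e∈p) j′ = there (end∈vertices p e∈p j′)

  -- If the first edge occurred again, its end `u` would lie on the rest of the walk as well.
  simple⇒uniqueEdges : ∀ {u v} (p : Walk G u v) → Simple p → Unique (walkEdges G p)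
  simple⇒uniqueEdges nil          _           = []
  simple⇒uniqueEdges (step _ j p) s@(_ ∷ s′) =
    ¬Any⇒All¬ _ (λ e∈p → Unique[x∷xs]⇒x∉xs s (end∈vertices p e∈p j)) ∷ simple⇒uniqueEdges p s′

  -- The closing edge has the start of the path as an end, so it could only be the first edge of the
  -- path, and then the path would be that edge alone. The bound 3 excludes this.
  closing∉path : ∀ {u v e} (p : Walk G u v) → Simple p → 3 ≤ length (vertices G p) →
    Joins e v u → e ∉ walkEdges G p
  closing∉path (step e j p) s@(_ ∷ s′) long j′ (here refl) with joins-unique j′ j
  ... | inj₁ (refl , _) = Unique[x∷xs]⇒x∉xs s (last∈vertices p)
  -- The first edge already reaches the last vertex, so the remaining simple walk is closed, hence
  -- empty, and the path has just two vertices.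
  ... | inj₂ (refl , _) with simple-closed p s′ | long
  ...   | refl | s≤s (s≤s ())
  closing∉path (step _ _ p) s _ j′ (there e∈p) =
    Unique[x∷xs]⇒x∉xs s (end∈vertices p e∈p (swap j′))

  uniqueEdges : (C : Cycle G) → Unique (Cycle.edges C)
  uniqueEdges C = Unique-++⁺ (simple⇒uniqueEdges walk simple) (All.[] ∷ [])
    λ { (e∈p , here refl) → closing∉path walk simple long closes e∈p }
    where
    open Cycle C
    open Path path

  -- Turns sums along a cycle into values of a linear map; used below both with class weights and
  -- with vertex incidences.
  linearExtension-edgeSet : ∀ {k} (h : Fin m → ℤ₂^ k) (C : Cycle G) →
    linearExtension h (edgeSet G C) ≡ sumOver h (Cycle.edges C)
  linearExtension-edgeSet h C = trans
    (sumOver-cong (λ e → cong (_· h e) (Vec.lookup∘tabulate _ e)) (allFin m))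
    (linearCombination-indicator h (uniqueEdges C))

  -- Sums along walks and potentials.

  module _ {k : ℕ} (h : Fin m → ℤ₂^ k) where

    walkSum : ∀ {u v} → Walk G u v → ℤ₂^ k
    walkSum p = sumOver h (walkEdges G p)

    walkSum-++ʷ : ∀ {u v w} (p : Walk G u v) (q : Walk G v w) →
      walkSum (p ++ʷ q) ≡ walkSum p ⊕ walkSum q
    walkSum-++ʷ p q = trans (cong (sumOver h) (walkEdges-++ʷ p q)) (sumOver-++ h (walkEdges G p) _)

    walkSum-∷ʳ : ∀ {u v w e} (p : Walk G u v) (j : Joins e v w) →
      walkSum (p ++ʷ step e j nil) ≡ walkSum p ⊕ h e
    walkSum-∷ʳ p j = trans (walkSum-++ʷ p (step _ j nil)) (cong (walkSum p ⊕_) (⊕-identityʳ _))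

    walkSum-reverse : ∀ {u v} (p : Walk G u v) → walkSum (reverse p) ≡ walkSum p
    walkSum-reverse nil          = refl
    walkSum-reverse (step e j p) = begin
      walkSum (reverse p ++ʷ step e (swap j) nil) ≡⟨ walkSum-∷ʳ (reverse p) (swap j) ⟩
      walkSum (reverse p) ⊕ h e                   ≡⟨ ⊕-comm _ (h e) ⟩
      h e ⊕ walkSum (reverse p)                   ≡⟨ cong (h e ⊕_) (walkSum-reverse p) ⟩
      h e ⊕ walkSum p                             ∎

    -- Says that `h` is the coboundary of `φ`. Modulo 2 a difference is a sum, so no orientation of
    -- the edges is involved.
    IsPotential : (Fin n → ℤ₂^ k) → Set
    IsPotential φ = ∀ {e u v} → Joins e u v → h e ≡ φ u ⊕ φ v

    walkSum-potential : ∀ {φ} → IsPotential φ → ∀ {u v} (p : Walk G u v) → walkSum p ≡ φ u ⊕ φ v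
    walkSum-potential {φ} _   {u} nil          = sym (⊕-self (φ u))
    walkSum-potential {φ} pot {u} (step _ j p) =
      trans (cong₂ _⊕_ (pot j) (walkSum-potential pot p)) (⊕-telescope (φ u) _ _)

    cycleSum-potential : ∀ {φ} → IsPotential φ → ∀ C → sumOver h (Cycle.edges {G = G} C) ≡ 𝟎
    cycleSum-potential {φ} pot C = begin
      sumOver h (walkEdges G walk ∷ʳ closing)  ≡⟨ sumOver-∷ʳ h (walkEdges G walk) closing ⟩
      walkSum walk ⊕ h closing                 ≡⟨ cong₂ _⊕_ (walkSum-potential pot walk) (pot closes) ⟩
      (φ first ⊕ φ last) ⊕ (φ last ⊕ φ first)  ≡⟨ ⊕-telescope (φ first) _ _ ⟩
      φ first ⊕ φ first                        ≡⟨ ⊕-self (φ first) ⟩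
      𝟎                                        ∎
      where
      open Cycle C
      open Path path

    -- A well-defined labeling is a potential.

    module _ (conn : Connected G) (r : Fin n)
             (wellDefined : ∀ v (P Q : Path G r v) →
               sumOver h (Path.edges P) ≡ sumOver h (Path.edges Q)) where

      label : Fin n → ℤ₂^ k
      label v = walkSum (Path.walk (conn r v))

      -- Since `v` is not on `p`, appending the edge gives a path again, and well-definedness
      -- applies at `v` as well as at `u`.
      label-step : ∀ {u v e} (p : Walk G r u) → Simple p → v ∉ vertices G p → Joins e u v →
        h e ≡ label u ⊕ label v
      label-step {u} {v} {e} p s v∉p j = begin
        h e                     ≡⟨ ⊕-cancelˡ (label u) (h e) ⟨
        label u ⊕ (label u ⊕ h e) ≡⟨ cong (label u ⊕_) (begin
          label u ⊕ h e   ≡⟨ cong (_⊕ h e) (wellDefined u (conn r u) (record { walk = p ; simple = s })) ⟩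
          walkSum p ⊕ h e ≡⟨ walkSum-∷ʳ p j ⟨
          walkSum (p ++ʷ step e j nil)
            ≡⟨ wellDefined v (record { walk = p ++ʷ step e j nil ; simple = simple-∷ʳ p j s v∉p }) (conn r v) ⟩
          label v ∎) ⟩
        label u ⊕ label v ∎

      label-potential : IsPotential label
      label-potential {e} {u} {v} j = along (conn r u)
        where
        -- If the path to u already passes through v, then its part up to v
        -- avoids u, and the edge can be appended there instead.
        along : Path G r u → h e ≡ label u ⊕ label v
        along record { walk = p ; simple = s } with v ∈? vertices G p
        ... | no v∉p  = label-step p s v∉p j
        ... | yes v∈p with splitAt p v∈p
        ...   | q , q′ , refl = trans
                (label-step q (simple-++ʷˡ q q′ s) u∉q (swap j)) (⊕-comm (label v) (label u))
          where
          u∉q : u ∉ vertices G q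
          -- `u` is the end of `q′`; if it were on `q` too it would be the junction `v`, making `e`
          -- a loop.
          u∉q u∈q with simple-++ʷ-meet q q′ s u∈q (last∈vertices q′)
          ... | refl = joins-irreflexive j

    -- Zero cycle sums make walk sums depend only on the ends.

    module _ (cycleSum≡𝟎 : ∀ C → sumOver h (Cycle.edges {G = G} C) ≡ 𝟎) where

      -- An empty path would make `e` a loop, and a path of one edge is `e` itself because there are
      -- no parallel edges. Any longer path is closed by `e` to a cycle, whose sum is zero.
      walkSum-closing : ∀ {u v e} (p : Walk G v u) → Simple p → Joins e u v → h e ≡ walkSum p
      walkSum-closing nil _ j = ⊥-elim (joins-irreflexive j)
      walkSum-closing (step e′ j′ nil) _ j =
        trans (cong h (no-parallel j (swap j′))) (sym (⊕-identityʳ (h e′)))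
      walkSum-closing {e = e} p@(step _ _ (step _ _ p′)) s j =
        sym (⊕≡𝟎⇒≡ (walkSum p) (h e) (trans (sym (sumOver-∷ʳ h (walkEdges G p) e)) (cycleSum≡𝟎 C)))
        where
        nonempty : 1 ≤ length (vertices G p′)
        nonempty with vertices G p′ | first∈vertices p′
        ... | _ ∷ _ | _ = s≤s z≤n

        C : Cycle G
        C = record
          { path    = record { walk = p ; simple = s }
          -- The first two vertices of `p`, and at least one on `p′`.
          ; long    = s≤s (s≤s nonempty)
          ; closing = e
          ; closes  = j
          }

      -- The path `q` found for the tail is simple, so putting `e` in front can repeat only `u`. The
      -- part `q₁` of `q` up to `u` then has the same sum as `e`, so the two cancel and `q₂`
      -- remains. Backtracking along `e` is the case where `q₁` is that single edge.
      eraseLoops : ∀ {u v} (p : Walk G u v) →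
        Σ (Path G u v) λ P → walkSum p ≡ walkSum (Path.walk P)
      eraseLoops nil = record { walk = nil ; simple = All.[] ∷ [] } , refl
      eraseLoops {u} (step e j p) with eraseLoops p
      ... | record { walk = q ; simple = s } , eq with u ∈? vertices G q
      ...   | no u∉q  = record { walk = step e j q ; simple = simple-step j u∉q s } , cong (h e ⊕_) eq
      ...   | yes u∈q with splitAt q u∈q
      ...     | q₁ , q₂ , refl = record { walk = q₂ ; simple = simple-++ʷʳ q₁ q₂ s } , (begin
        h e ⊕ walkSum p                      ≡⟨ cong₂ _⊕_ (walkSum-closing q₁ (simple-++ʷˡ q₁ q₂ s) j)
                                                  (trans eq (walkSum-++ʷ q₁ q₂)) ⟩
        walkSum q₁ ⊕ (walkSum q₁ ⊕ walkSum q₂) ≡⟨ ⊕-cancelˡ (walkSum q₁) _ ⟩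
        walkSum q₂                           ∎)

      -- The only path from a vertex to itself is `nil`, so erasing loops leaves an empty sum.
      walkSum-closed : ∀ {u} (p : Walk G u u) → walkSum p ≡ 𝟎
      walkSum-closed p with eraseLoops p
      ... | record { walk = q ; simple = s } , eq = trans eq (cong walkSum (simple-closed q s))

      walkSum-unique : ∀ {u v} (p q : Walk G u v) → walkSum p ≡ walkSum q
      walkSum-unique p q = ⊕≡𝟎⇒≡ _ _ (begin
        walkSum p ⊕ walkSum q           ≡⟨ cong (walkSum p ⊕_) (walkSum-reverse q) ⟨
        walkSum p ⊕ walkSum (reverse q) ≡⟨ walkSum-++ʷ p (reverse q) ⟨
        walkSum (p ++ʷ reverse q)       ≡⟨ walkSum-closed (p ++ʷ reverse q) ⟩
        𝟎                               ∎)

  -- Cycle space membership and reduction to a cycle basis.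

  -- A row of the incidence matrix modulo 2, with values in `ℤ₂^ 1` so that it can serve as an edge
  -- weight.
  incidence : Fin n → Fin m → ℤ₂^ 1
  incidence v e = ⟦ incident? v e ⟧ ∷ []

  -- Modulo 2 the conjunction tested in `degree` is a product of indicators, which makes the degree
  -- at `v` linear in `x`.
  degree-parity : ∀ x v → parity (degree G x v) ∷ [] ≡ linearExtension (incidence v) x
  degree-parity x v = trans
    (length-filter-parity (λ e → (lookup x e ℙ.≟ 1ℙ) ×-dec incident? v e) (allFin m))
    (sumOver-cong (λ e → cong (_∷ []) (⟦⟧-×-dec (lookup x e) (incident? v e))) (allFin m))

  -- Being incident is a disjunction, which agrees with the sum modulo 2 unless both ends equal `v`;
  -- looplessness rules that out. The stored order of the ends is absorbed by commutativity.
  incidence-potential : ∀ v → IsPotential (incidence v) (λ u → ⟦ u ≟ v ⟧ ∷ [])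
  incidence-potential v {e} {a} {b} j =
    cong (_∷ []) (trans (either (ends e) (loopless e)) (orient j))
    where
    either : ∀ ((x , y) : Fin n × Fin n) → x ≢ y →
      ⟦ (x ≟ v) ⊎-dec (y ≟ v) ⟧ ≡ ⟦ x ≟ v ⟧ ℙ.+ ⟦ y ≟ v ⟧
    either (x , y) x≢y with x ≟ v | y ≟ v
    ... | yes refl | yes refl = contradiction refl x≢y
    ... | yes _    | no _     = refl
    ... | no _     | yes _    = refl
    ... | no _     | no _     = refl

    orient : Joins e a b →
      ⟦ proj₁ (ends e) ≟ v ⟧ ℙ.+ ⟦ proj₂ (ends e) ≟ v ⟧ ≡ ⟦ a ≟ v ⟧ ℙ.+ ⟦ b ≟ v ⟧
    orient (inj₁ eq) = cong (λ (x , y) → ⟦ x ≟ v ⟧ ℙ.+ ⟦ y ≟ v ⟧) eq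
    orient (inj₂ eq) = trans
      (cong (λ (x , y) → ⟦ x ≟ v ⟧ ℙ.+ ⟦ y ≟ v ⟧) eq) (ℙ.+-comm ⟦ b ≟ v ⟧ ⟦ a ≟ v ⟧)

  -- A cycle basis spans the space defined by even degrees, so this membership is what allows an
  -- arbitrary cycle to be expanded in the basis.
  edgeSet∈CycleSpace : ∀ C → CycleSpace G (edgeSet G C)
  edgeSet∈CycleSpace C v = parity-even (degree G (edgeSet G C) v) (cong head (begin
    parity (degree G (edgeSet G C) v) ∷ []          ≡⟨ degree-parity (edgeSet G C) v ⟩
    linearExtension (incidence v) (edgeSet G C)     ≡⟨ linearExtension-edgeSet (incidence v) C ⟩
    sumOver (incidence v) (Cycle.edges C)           ≡⟨ cycleSum-potential (incidence v) {φ = λ u → ⟦ u ≟ v ⟧ ∷ []}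
                                                         (incidence-potential v) C ⟩
    𝟎                                               ∎))

  cycleSum-basis : ∀ {k d} (h : Fin m → ℤ₂^ k) (B : Fin d → Cycle G) → IsCycleBasis G B →
    (∀ i → sumOver h (Cycle.edges (B i)) ≡ 𝟎) → ∀ (C : Cycle G) → sumOver h (Cycle.edges C) ≡ 𝟎
  cycleSum-basis h B basis B≡𝟎 C with IsBasis.spanning basis (edgeSet G C) (edgeSet∈CycleSpace C)
  ... | c , eq = begin
    sumOver h (Cycle.edges C)                               ≡⟨ linearExtension-edgeSet h C ⟨
    linearExtension h (edgeSet G C)                         ≡⟨ cong (linearExtension h) eq ⟨
    linearExtension h (linearCombination c (edgeSet G ∘ B)) ≡⟨ linearExtension-kernel h c (edgeSet G ∘ B)
                                                                 (λ i → trans (linearExtension-edgeSet h (B i)) (B≡𝟎 i)) ⟩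
    𝟎                                                       ∎

theorem3 : ∀ {n m t k : ℕ} (G : Graph n m) → Connected G → (r : Fin n) →
    (𝓟 : Partition m t) (g : Fin t → ℤ₂^ k) →
    (LabelingWellDefined 𝓟 g G r ⇔ (∀ (C : Cycle G) → SumsToZero 𝓟 g G C))
    × (∀ {d : ℕ} (B : Fin d → Cycle G) → IsCycleBasis G B →
        (∀ i → SumsToZero 𝓟 g G (B i)) → ∀ (C : Cycle G) → SumsToZero 𝓟 g G C)
theorem3 G conn r 𝓟 g =
  mk⇔ (λ wellDefined → cycleSum-potential G h (label-potential G h conn r wellDefined))
      (λ cycleSum≡𝟎 v P Q → walkSum-unique G h cycleSum≡𝟎 (Path.walk P) (Path.walk Q))
  , cycleSum-basis G h
  -- Each edge carries the weight of its class, so `classSum` unfolds to `sumOver h`.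
  where h = g ∘ Partition.class 𝓟
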